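{- Every split graph, every co-bipartite graph and every mixed unit interval graph belongs to $\mathsf{BW}_1$; that is, $\mathsf{Split}\cup\mathsf{Co\text{ - }Bipartite}\cup\mathsf{MixedUnitInterval}\subseteq\mathsf{BW}_1$.
   Context: Graphs are finite and simple. A split graph is one whose vertex set can be partitioned into a clique and an independent set; a co-bipartite graph is one whose vertex set can be partitioned into two cliques; a mixed unit interval graph is the intersection graph of a finite family of unit-length intervals of the real line, each of which may be open, closed, or open at one end and closed at the other. $\mathsf{Split}$, $\mathsf{Co\text{ - }Bipartite}$ and $\mathsf{MixedUnitInterval}$ denote these classes. Two adjacent vertices $u,v$ of $G$ are twins if $N_G(u)\setminus\{v\} = N_G(v)\setminus\{u\}$. A bubble of $G$ is a maximal set of pairwise twin vertices (possibly a single vertex); the bubbles partition $V(G)$. A bubble partition of $G$ is a partition $\mathcal V=\{V_1,\dots,V_k\}$ of $V(G)$ such that every $V_i$ is a union of bubbles of $G$ and the graph obtained from $G$ by contracting every $V_i$ to a single vertex (vertices $i\neq j$ being adjacent iff $G$ has an edge between $V_i$ and $V_j$) is a tree, possibly with a single vertex. The independence number of $\mathcal V$ is $\alpha(\mathcal V)=\max_i\alpha(G[V_i])$, where $\alpha(H)$ is the maximum size of an independent set of $H$. $\mathsf{BW}_1$ is the class of graphs that have a bubble partition $\mathcal V$ with $\alpha(\mathcal V)\le 1$ (i.e. every $V_i$ is a clique).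
   Formalization: The graphs are assumed connected and nonempty: two isolated vertices form a split, co-bipartite and mixed unit interval graph, yet contracting a partition into cliques gives no tree; no disconnected or empty graph belongs to BW_1. -}

module Defs where

open import Data.Bool.Base using (Bool; if_then_else_)
open import Data.Fin.Base using (Fin; zero; suc; inject₁; fromℕ)
open import Data.Fin.Properties using (_≟_; all?; any?)
open import Data.Fin.Subset
  using (Subset; inside; outside; _∈_; _⊆_; ∁; _-_; ⋃; ∣_∣; Nonempty)
open import Data.Fin.Subset.Properties using (_∈?_)
open import Data.List.Base using (List; []; _∷_; map; _++_; filter; tabulate)
open import Data.List.Extrema.Nat using (max)
open import Data.List.Relation.Unary.All using (All)
open import Data.Nat.Base as ℕ using (ℕ; zero; suc)
open import Data.Product.Base using (Σ; ∃; ∃₂; _×_; _,_)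
open import Data.Rational.Base as ℚ using (ℚ; 1ℚ)
import Data.Rational.Properties as ℚ
open import Data.Sum.Base using (_⊎_)
import Data.Vec.Base as Vec
open import Function.Base using (_∘_)
open import Function.Bundles using (_⇔_)
open import Function.Definitions using (Injective)
open import Level using (0ℓ)
open import Relation.Binary.Core using (Rel)
open import Relation.Binary.Construct.Closure.ReflexiveTransitive using (Star)
open import Relation.Binary.Definitions using (Decidable; Symmetric)
open import Relation.Binary.PropositionalEquality
  using (_≡_; _≢_; refl; sym; trans; cong; subst)
open import Relation.Nullary using (¬_; Dec; does; ¬?; _×-dec_; _→-dec_)

------------------------------------------------------------------------
-- Finite simple graphs

record Graph : Set₁ where
  infix 4 _~_ _~?_
  field
    order    : ℕ
    _~_      : Rel (Fin order) 0ℓ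
    ~-sym    : Symmetric _~_
    ~-irrefl : ∀ {u} → ¬ (u ~ u)
    _~?_     : Decidable _~_

  Vertex : Set
  Vertex = Fin order

  VertexSet : Set
  VertexSet = Subset order

  N : Vertex → VertexSet
  N u = Vec.tabulate λ v → does (u ~? v)

  Clique : VertexSet → Set
  Clique S = ∀ u v → u ∈ S → v ∈ S → u ≢ v → u ~ v

  Independent : VertexSet → Set
  Independent S = ∀ u v → u ∈ S → v ∈ S → ¬ (u ~ v)

  independent? : ∀ S → Dec (Independent S)
  independent? S = all? λ u → all? λ v →
    (u ∈? S) →-dec (v ∈? S) →-dec ¬? (u ~? v)

open Graph using (Vertex; VertexSet)

Connected : Graph → Set
Connected G = Vertex G × (∀ u v → Star _~_ u v)
  where open Graph G using (_~_)

-- The vertices of a cycle of length 3 + m in cyclic order.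
record Cycle (G : Graph) : Set where
  open Graph G using (_~_)
  field
    m         : ℕ
    at        : Fin (3 ℕ.+ m) → Vertex G
    injective : Injective _≡_ _≡_ at
    step      : ∀ (i : Fin (2 ℕ.+ m)) → at (inject₁ i) ~ at (suc i)
    close     : at (fromℕ (2 ℕ.+ m)) ~ at zero

Tree : Graph → Set
Tree G = Connected G × ¬ Cycle G

------------------------------------------------------------------------
-- Induced subgraphs and the independence number

-- The increasing enumeration of the elements of a subset.
element : ∀ {n} (S : Subset n) → Fin ∣ S ∣ → Fin n
element (inside  Vec.∷ S) zero    = zero
element (inside  Vec.∷ S) (suc i) = suc (element S i)
element (outside Vec.∷ S) i       = suc (element S i)

infix 8 _[_]

_[_] : (G : Graph) → VertexSet G → Graph
G [ S ] = record
  { order    = ∣ S ∣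
  ; _~_      = λ i j → element S i ~ element S j
  ; ~-sym    = ~-sym
  ; ~-irrefl = ~-irrefl
  ; _~?_     = λ i j → element S i ~? element S j
  } where open Graph G using (_~_; ~-sym; ~-irrefl; _~?_)

allSubsets : ∀ n → List (Subset n)
allSubsets zero    = Vec.[] ∷ []
allSubsets (suc n) = map (inside Vec.∷_) (allSubsets n)
                  ++ map (outside Vec.∷_) (allSubsets n)

-- The default value 0 of the maximum is the size of the empty set,
-- which is always independent.
α : Graph → ℕ
α G = max 0 (map ∣_∣ (filter independent? (allSubsets order)))
  where open Graph G using (order; independent?)

------------------------------------------------------------------------
-- Bubbles

module _ (G : Graph) where
  open Graph G using (_~_; N)

  Twins : Vertex G → Vertex G → Set
  Twins u v = u ~ v × N u - v ≡ N v - u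

  PairwiseTwins : VertexSet G → Set
  PairwiseTwins S = ∀ u v → u ∈ S → v ∈ S → u ≢ v → Twins u v

  Bubble : VertexSet G → Set
  Bubble S = Nonempty S × PairwiseTwins S
           × (∀ T → PairwiseTwins T → S ⊆ T → T ⊆ S)

  UnionOfBubbles : VertexSet G → Set
  UnionOfBubbles S = ∃ λ Bs → All Bubble Bs × ⋃ Bs ≡ S

------------------------------------------------------------------------
-- Bubble partitions

record Partition (n : ℕ) : Set where
  field
    size     : ℕ
    part     : Fin size → Subset n
    nonempty : ∀ i → Nonempty (part i)
    disjoint : ∀ {i j} v → v ∈ part i → v ∈ part j → i ≡ j
    covering : ∀ v → ∃ λ i → v ∈ part i

contract : (G : Graph) → Partition (Graph.order G) → Graph
contract G 𝒱 = record
  { order    = size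
  ; _~_      = λ i j → i ≢ j × Touch i j
  ; ~-sym    = λ (i≢j , u , v , u∈ , v∈ , u~v) →
                 i≢j ∘ sym , v , u , v∈ , u∈ , ~-sym u~v
  ; ~-irrefl = λ (i≢i , _) → i≢i refl
  ; _~?_     = λ i j → ¬? (i ≟ j) ×-dec any? λ u → any? λ v →
                 (u ∈? part i) ×-dec (v ∈? part j) ×-dec (u ~? v)
  }
  where
  open Graph G using (_~_; _~?_; ~-sym)
  open Partition 𝒱
  Touch : Fin size → Fin size → Set
  Touch i j = ∃₂ λ u v → u ∈ part i × v ∈ part j × u ~ v

record BubblePartition (G : Graph) : Set where
  field
    partition : Partition (Graph.order G)
  open Partition partition public
  field
    bubbles : ∀ i → UnionOfBubbles G (part i)
    tree    : Tree (contract G partition)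

-- There is at least one part, since a tree has a vertex, so the default
-- value 0 never matters.
αᴾ : ∀ {G} → BubblePartition G → ℕ
αᴾ {G} 𝒱 = max 0 (tabulate λ i → α (G [ part i ]))
  where open BubblePartition 𝒱

-- A partition into cliques whose contraction is a tree forces G to be
-- connected: 2K₁ is split, yet not in BW₁.  Inclusions of graph classes
-- in BW₁ therefore only make sense for connected graphs.
BW₁ : Graph → Set
BW₁ G = Σ (BubblePartition G) λ 𝒱 → αᴾ 𝒱 ℕ.≤ 1

------------------------------------------------------------------------
-- Split and co-bipartite graphs

Split : Graph → Set
Split G = ∃ λ S → Clique S × Independent (∁ S)
  where open Graph G using (Clique; Independent)

CoBipartite : Graph → Set
CoBipartite G = ∃ λ S → Clique S × Clique (∁ S)
  where open Graph G using (Clique)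

------------------------------------------------------------------------
-- The real line: two-sided located Dedekind cuts of ℚ

record ℝ : Set₁ where
  field
    -- Lower q means q < x and Upper q means x < q.
    Lower Upper     : ℚ → Set
    lower-inhabited : ∃ Lower
    upper-inhabited : ∃ Upper
    lower-closed    : ∀ {q r} → q ℚ.< r → Lower r → Lower q
    upper-closed    : ∀ {q r} → q ℚ.< r → Upper q → Upper r
    lower-open      : ∀ {q} → Lower q → ∃ λ r → q ℚ.< r × Lower r
    upper-open      : ∀ {r} → Upper r → ∃ λ q → q ℚ.< r × Upper q
    disjoint        : ∀ {q} → ¬ (Lower q × Upper q)
    located         : ∀ {q r} → q ℚ.< r → Lower q ⊎ Upper r

infix 4 _<_ _≤_

_<_ : Rel ℝ 0ℓ
x < y = ∃ λ q → ℝ.Upper x q × ℝ.Lower y q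

_≤_ : Rel ℝ 0ℓ
x ≤ y = ¬ (y < x)

private
  cancel : ∀ q t → (q ℚ.+ t) ℚ.- t ≡ q
  cancel q t = trans (ℚ.+-assoc q t (ℚ.- t))
    (trans (cong (q ℚ.+_) (ℚ.+-inverseʳ t)) (ℚ.+-identityʳ q))

  cancel′ : ∀ q t → (q ℚ.- t) ℚ.+ t ≡ q
  cancel′ q t = trans (ℚ.+-assoc q (ℚ.- t) t)
    (trans (cong (q ℚ.+_) (ℚ.+-inverseˡ t)) (ℚ.+-identityʳ q))

infixl 6 _+_

_+_ : ℝ → ℚ → ℝ
x + t = record
  { Lower           = λ q → Lower (q ℚ.- t)
  ; Upper           = λ q → Upper (q ℚ.- t)
  ; lower-inhabited = let q , l = lower-inhabited in
                      q ℚ.+ t , subst Lower (sym (cancel q t)) l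
  ; upper-inhabited = let q , u = upper-inhabited in
                      q ℚ.+ t , subst Upper (sym (cancel q t)) u
  ; lower-closed    = λ q<r → lower-closed (shift q<r)
  ; upper-closed    = λ q<r → upper-closed (shift q<r)
  ; lower-open      = λ {q} l → let r , q<r , l′ = lower-open l in
                      r ℚ.+ t ,
                      subst (ℚ._< r ℚ.+ t) (cancel′ q t) (ℚ.+-monoˡ-< t q<r) ,
                      subst Lower (sym (cancel r t)) l′
  ; upper-open      = λ {r} u → let q , q<r , u′ = upper-open u in
                      q ℚ.+ t ,
                      subst (q ℚ.+ t ℚ.<_) (cancel′ r t) (ℚ.+-monoˡ-< t q<r) ,
                      subst Upper (sym (cancel q t)) u′
  ; disjoint        = disjoint
  ; located         = λ q<r → located (shift q<r)
  }
  where
  open ℝ x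
  shift : ∀ {q r} → q ℚ.< r → q ℚ.- t ℚ.< r ℚ.- t
  shift = ℚ.+-monoˡ-< (ℚ.- t)

------------------------------------------------------------------------
-- Mixed unit interval graphs

record UnitInterval : Set₁ where
  field
    left        : ℝ
    leftClosed  : Bool
    rightClosed : Bool

  right : ℝ
  right = left + 1ℚ

  Contains : ℝ → Set
  Contains x = (if leftClosed  then left ≤ x  else left < x)
             × (if rightClosed then x ≤ right else x < right)

Intersect : UnitInterval → UnitInterval → Set₁
Intersect I J = ∃ λ x → Contains I x × Contains J x
  where open UnitInterval

-- The family is indexed by the vertices, so distinct vertices may have
-- equal intervals.
MixedUnitInterval : Graph → Set₁
MixedUnitInterval G = Σ (Vertex G → UnitInterval) λ I →
  ∀ u v → (u ~ v) ⇔ (u ≢ v × Intersect (I u) (I v))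
  where open Graph G using (_~_)

{-# OPTIONS --safe #-}
module Submission where

open import Defs
open import Relation.Unary using (_∈_; _∪_)

open import Data.Bool.Base using (true; false; if_then_else_)
open import Data.Bool.Properties as Bool using ()
open import Data.Empty using (⊥-elim)
open import Data.Fin.Base as Fin using (Fin; zero; suc; inject₁; fromℕ)
open import Data.Fin.Properties
  using (_≟_; all?; any?; sequence; suc-injective; 0≢1+n; toℕ-injective; toℕ-fromℕ<)
open import Data.Fin.Relation.Unary.Top using (view; ‵fromℕ; ‵inject₁)
open import Data.Fin.Subset as Subset using (Subset; inside; outside; ⁅_⁆; ∁; _─_; _-_; ⋃; ∣_∣)
open import Data.Fin.Subset.Properties as Subset
  using (_∈?_; ⊆-antisym; x∈p∪q⁺; x∈p∪q⁻; p─q⊆p; x∈p∧x≢y⇒x∈p-y; x∈⁅x⁆; ∉⊥)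
import Data.Integer.Base as ℤ
import Data.Integer.Properties as ℤ
open import Data.List.Base as List using (List; []; _∷_; allFin; deduplicate)
open import Data.List.Extrema.Nat using (argmax; f[xs]≤f[argmax]; max≤v⁺)
open import Data.List.Membership.Propositional as List using ()
open import Data.List.Membership.Propositional.Properties
  using (∈-lookup; ∈-allFin; ∈-map⁺; ∈-map⁻; ∈-filter⁺; ∈-filter⁻; ∈-deduplicate⁺; ∈-deduplicate⁻)
open import Data.List.Relation.Unary.All as All using ()
import Data.List.Relation.Unary.All.Properties as All
open import Data.List.Relation.Unary.AllPairs using (_∷_)
open import Data.List.Relation.Unary.Any as Any using (here; there)
open import Data.List.Relation.Unary.Any.Properties using (lookup-index)
open import Data.List.Relation.Unary.Unique.Propositional using (Unique)
open import Data.List.Relation.Unary.Unique.DecPropositional.Properties using (deduplicate-!)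
open import Data.Nat.Base as ℕ using (ℕ; zero; suc; z≤n; s≤s)
import Data.Nat.Properties as ℕ
open import Data.Product.Base using (∃; _×_; _,_; proj₁; proj₂)
open import Data.Rational.Base as ℚ using (ℚ; 0ℚ; 1ℚ)
import Data.Rational.Properties as ℚ
import Data.Rational.Unnormalised.Base as ℚᵘ
import Data.Rational.Unnormalised.Properties as ℚᵘ
open import Data.Sum.Base as Sum using (_⊎_; inj₁; inj₂; [_,_]; [_,_]′)
open import Data.Unit.Base using (⊤; tt)
open import Data.Vec.Base as Vec using (Vec; []; _∷_)
import Data.Vec.Properties as Vec
open import Effect.Monad using (RawMonad)
open import Function.Base using (_∘_; const)
open import Function.Bundles using (Equivalence)
open import Relation.Binary.Construct.Closure.ReflexiveTransitive using (Star; ε; _◅_)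
open import Relation.Binary.Definitions using (tri<; tri≈; tri>)
open import Relation.Binary.PropositionalEquality hiding ([_])
open import Relation.Nullary
open import Relation.Nullary.Decidable
  using (dec-true; map′; decidable-stable; ¬¬-excluded-middle)
open import Relation.Nullary.Negation using (¬¬-Monad; ¬¬-map)

-- A labelling of the vertices by natural numbers that is constant on twins, whose levels are cliques,
-- and in which the lower end of every edge between two levels is determined by the level of its upper
-- end, yields the required partition: on a cycle of levels the highest one would have two lower
-- neighbours.  A split graph with a maximal clique K gets 0 on K and distinct positive labels elsewhere
-- (a star); a co-bipartite graph gets two levels, universal vertices being moved to the lower one.  In
-- a mixed unit interval model with equal intervals for twins, label v by the length of a longest chain
-- of unit steps between left endpoints ending at v; the levels then form a path.

-- Subsets of Fin n

module _ {n} {P : Fin n → Set} (P? : ∀ x → Dec (P x)) where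

  ⟪_⟫ : Subset n
  ⟪_⟫ = Vec.tabulate (does ∘ P?)

  ∈⟪⟫⁺ : ∀ {x} → P x → x Subset.∈ ⟪_⟫
  ∈⟪⟫⁺ {x} px = Vec.lookup⇒[]= x _
    (trans (Vec.lookup∘tabulate (does ∘ P?) x) (dec-true (P? x) px))

  ∈⟪⟫⁻ : ∀ {x} → x Subset.∈ ⟪_⟫ → P x
  ∈⟪⟫⁻ {x} x∈ with P? x | trans (sym (Vec.lookup∘tabulate (does ∘ P?) x)) (Vec.[]=⇒lookup x∈)
  ... | yes px | _  = px
  ... | no  _  | ()

x∈p─q⇒x∉q : ∀ {n x} (p q : Subset n) → x Subset.∈ p ─ q → x Subset.∉ q
x∈p─q⇒x∉q (_ ∷ p) (_       ∷ q) (Vec.there x∈) (Vec.there x∈q) = x∈p─q⇒x∉q p q x∈ x∈q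
x∈p─q⇒x∉q (_ ∷ p) (inside  ∷ q) () Vec.here

x∈p-y⇒x≢y : ∀ {n x y} (p : Subset n) → x Subset.∈ p - y → x ≢ y
x∈p-y⇒x≢y {y = y} p x∈ refl = x∈p─q⇒x∉q p ⁅ y ⁆ x∈ (x∈⁅x⁆ y)

∈⋃⁺ : ∀ {n x} {p : Subset n} {ps} → p List.∈ ps → x Subset.∈ p → x Subset.∈ ⋃ ps
∈⋃⁺ (here refl) x∈p = x∈p∪q⁺ (inj₁ x∈p)
∈⋃⁺ (there p∈)  x∈p = x∈p∪q⁺ (inj₂ (∈⋃⁺ p∈ x∈p))

∈⋃⁻ : ∀ {n x} (ps : List (Subset n)) → x Subset.∈ ⋃ ps → ∃ λ p → p List.∈ ps × x Subset.∈ p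
∈⋃⁻ []       x∈ = ⊥-elim (∉⊥ x∈)
∈⋃⁻ (p ∷ ps) x∈ with x∈p∪q⁻ p (⋃ ps) x∈
... | inj₁ x∈p = p , here refl , x∈p
... | inj₂ x∈⋃ = let q , q∈ , x∈q = ∈⋃⁻ ps x∈⋃ in q , there q∈ , x∈q

element∈ : ∀ {n} (S : Subset n) i → element S i Subset.∈ S
element∈ (inside  ∷ S) zero    = Vec.here
element∈ (inside  ∷ S) (suc i) = Vec.there (element∈ S i)
element∈ (outside ∷ S) i       = Vec.there (element∈ S i)

element-injective : ∀ {n} (S : Subset n) {i j} → element S i ≡ element S j → i ≡ j
element-injective (inside  ∷ S) {zero}  {zero}  _  = refl
element-injective (inside  ∷ S) {suc i} {suc j} eq = cong suc (element-injective S (suc-injective eq))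
element-injective (outside ∷ S)                 eq = element-injective S (suc-injective eq)

∣S∣≤1 : ∀ {n} (S : Subset n) → (∀ {x y} → x Subset.∈ S → y Subset.∈ S → x ≡ y) → ∣ S ∣ ℕ.≤ 1
∣S∣≤1 S unique with ∣ S ∣ in eq
... | zero        = z≤n
... | suc zero    = s≤s z≤n
... | suc (suc k) = ⊥-elim (distinct (element-injective S (unique (element∈ S i) (element∈ S j))))
  where
  i j : Fin ∣ S ∣
  i = subst Fin (sym eq) zero
  j = subst Fin (sym eq) (suc zero)
  distinct : i ≢ j
  distinct i≡j = 0≢1+n (trans (sym (subst-subst-sym eq)) (trans (cong (subst Fin eq) i≡j) (subst-subst-sym eq)))

lookup-injective : ∀ {A : Set} {xs : List A} → Unique xs →
                   ∀ {i j} → List.lookup xs i ≡ List.lookup xs j → i ≡ j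
lookup-injective (x∉ ∷ u) {zero}  {zero}  eq = refl
lookup-injective (x∉ ∷ u) {zero}  {suc j} eq = ⊥-elim (All.lookup x∉ (∈-lookup j) eq)
lookup-injective (x∉ ∷ u) {suc i} {zero}  eq = ⊥-elim (All.lookup x∉ (∈-lookup i) (sym eq))
lookup-injective (x∉ ∷ u) {suc i} {suc j} eq = cong suc (lookup-injective u eq)

-- Independence number of a clique.

module _ (G : Graph) where
  open Graph G

  -- `element S` is injective, so two members of an independent set of `G [ S ]` would be distinct
  -- vertices of the clique, hence adjacent.
  clique⇒α≤1 : ∀ {S : VertexSet} → Clique S → α (G [ S ]) ℕ.≤ 1
  clique⇒α≤1 {S} clique = max≤v⁺ {⊥ = 0} {xs = List.map ∣_∣ (List.filter G[S].independent? subsets)} z≤n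
    (All.map⁺ (All.tabulate λ {T} T∈ →
      ∣S∣≤1 T (independent⇒≡ (proj₂ (∈-filter⁻ G[S].independent? {xs = subsets} T∈)))))
    where
    module G[S] = Graph (G [ S ])
    subsets = allSubsets ∣ S ∣

    independent⇒≡ : ∀ {T} → G[S].Independent T → ∀ {i j} → i Subset.∈ T → j Subset.∈ T → i ≡ j
    independent⇒≡ independent {i} {j} i∈T j∈T with i ≟ j
    ... | yes i≡j = i≡j
    ... | no  i≢j = ⊥-elim (independent i j i∈T j∈T
      (clique _ _ (element∈ S i) (element∈ S j) (i≢j ∘ element-injective S)))

  -- Closed neighbourhoods

  infix 4 _≃_ _≃?_

  _≃_ : Vertex → Vertex → Set
  u ≃ v = u ≡ v ⊎ u ~ v

  _≃?_ : ∀ u v → Dec (u ≃ v)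
  u ≃? v = (u ≟ v) ⊎-dec (u ~? v)

  ≃-sym : ∀ {u v} → u ≃ v → v ≃ u
  ≃-sym = Sum.map sym ~-sym

  -- Distinct vertices are twins exactly when their closed neighbourhoods agree. Unlike `Twins`,
  -- equality of `N⁺` is also reflexive, so its classes are the bubbles.
  N⁺ : Vertex → VertexSet
  N⁺ u = ⟪ u ≃?_ ⟫

  _≗ᴺ?_ : ∀ u v → Dec (N⁺ u ≡ N⁺ v)
  u ≗ᴺ? v = Vec.≡-dec Bool._≟_ (N⁺ u) (N⁺ v)

  N⁺-≡⁻ : ∀ {u v} → N⁺ u ≡ N⁺ v → ∀ {w} → u ≃ w → v ≃ w
  N⁺-≡⁻ {u} {v} eq u≃w = ∈⟪⟫⁻ (v ≃?_) (subst (_ Subset.∈_) eq (∈⟪⟫⁺ (u ≃?_) u≃w))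

  twins-⊆ : ∀ {u v w} → Twins G u v → u ≃ w → v ≃ w
  twins-⊆ (u~v , _) (inj₁ refl) = inj₂ (~-sym u~v)
  twins-⊆ {u} {v} {w} (u~v , eq) (inj₂ u~w) with w ≟ v
  ... | yes refl = inj₁ refl
  ... | no  w≢v  = inj₂ (∈⟪⟫⁻ (v ~?_) (p─q⊆p (N v) ⁅ u ⁆
                     (subst (w Subset.∈_) eq (x∈p∧x≢y⇒x∈p-y (∈⟪⟫⁺ (u ~?_) u~w) w≢v))))

  twins-sym : ∀ {u v} → Twins G u v → Twins G v u
  twins-sym (u~v , eq) = ~-sym u~v , sym eq

  twins⇒N⁺≡ : ∀ {u v} → Twins G u v → N⁺ u ≡ N⁺ v
  twins⇒N⁺≡ {u} {v} t = ⊆-antisym (half t) (half (twins-sym t))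
    where
    half : ∀ {u v} → Twins G u v → N⁺ u Subset.⊆ N⁺ v
    half {u} {v} t w∈ = ∈⟪⟫⁺ (v ≃?_) (twins-⊆ t (∈⟪⟫⁻ (u ≃?_) w∈))

  N⁺≡⇒twins : ∀ {u v} → u ≢ v → N⁺ u ≡ N⁺ v → Twins G u v
  N⁺≡⇒twins {u} {v} u≢v eq = ~-sym v~u , ⊆-antisym (half eq) (half (sym eq))
    where
    -- `u` lies in its own closed neighbourhood, hence in that of `v`.
    v~u : v ~ u
    v~u = [ ⊥-elim ∘ u≢v ∘ sym , (λ e → e) ] (N⁺-≡⁻ eq (inj₁ refl))
    half : ∀ {u v} → N⁺ u ≡ N⁺ v → N u - v Subset.⊆ N v - u
    half {u} {v} eq {w} w∈ with N⁺-≡⁻ eq (inj₂ u~w)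
      where u~w = ∈⟪⟫⁻ (u ~?_) (p─q⊆p (N u) ⁅ v ⁆ w∈)
    ... | inj₁ v≡w = ⊥-elim (x∈p-y⇒x≢y (N u) w∈ (sym v≡w))
    ... | inj₂ v~w = x∈p∧x≢y⇒x∈p-y (∈⟪⟫⁺ (v ~?_) v~w)
      λ { refl → ~-irrefl (∈⟪⟫⁻ (u ~?_) (p─q⊆p (N u) ⁅ v ⁆ w∈)) }

  bubbleOf : Vertex → VertexSet
  bubbleOf v = ⟪ _≗ᴺ? v ⟫

  -- For maximality: in a set of pairwise twins that contains `v`, every vertex has the closed
  -- neighbourhood of `v`.
  bubbleOf-bubble : ∀ v → Bubble G (bubbleOf v)
  bubbleOf-bubble v =
      (v , self)
    , (λ u w u∈ w∈ u≢w → N⁺≡⇒twins u≢w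
        (trans (∈⟪⟫⁻ (_≗ᴺ? v) u∈) (sym (∈⟪⟫⁻ (_≗ᴺ? v) w∈))))
    , maximal
    where
    self : v Subset.∈ bubbleOf v
    self = ∈⟪⟫⁺ (_≗ᴺ? v) refl
    maximal : ∀ T → PairwiseTwins G T → bubbleOf v Subset.⊆ T → T Subset.⊆ bubbleOf v
    maximal T twins S⊆T {w} w∈T with w ≟ v
    ... | yes refl = self
    ... | no  w≢v  = ∈⟪⟫⁺ (_≗ᴺ? v) (twins⇒N⁺≡ (twins w v w∈T (S⊆T self) w≢v))

  -- The list takes the bubble of every vertex of `S`; repetitions are absorbed by the union, and
  -- closure under twins keeps each bubble inside `S`.
  unionOfBubbles : ∀ S → (∀ {u v} → N⁺ u ≡ N⁺ v → v Subset.∈ S → u Subset.∈ S) →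
                   UnionOfBubbles G S
  unionOfBubbles S closed = Bs , All.map⁺ (All.tabulate λ {v} _ → bubbleOf-bubble v) ,
    ⊆-antisym ⋃⊆S λ {v} v∈S →
      ∈⋃⁺ (∈-map⁺ bubbleOf (∈-filter⁺ (_∈? S) (∈-allFin v) v∈S)) (∈⟪⟫⁺ (_≗ᴺ? v) refl)
    where
    Bs : List VertexSet
    Bs = List.map bubbleOf (List.filter (_∈? S) (allFin order))
    ⋃⊆S : ⋃ Bs Subset.⊆ S
    ⋃⊆S {u} u∈ with ∈⋃⁻ Bs u∈
    ... | _ , B∈ , u∈B with ∈-map⁻ bubbleOf B∈
    ... | v , v∈ , refl = closed (∈⟪⟫⁻ (_≗ᴺ? v) u∈B) (proj₂ (∈-filter⁻ (_∈? S) {xs = allFin order} v∈))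

-- Tree labellings

-- `parent` acts on labels rather than on vertices, so that the last condition passes to the
-- contraction, whose vertices are the levels.
record TreeLabelling (G : Graph) (parent : ℕ → ℕ) (f : Graph.Vertex G → ℕ) : Set where
  open Graph G
  field
    twins→same : ∀ u v → N⁺ G u ≡ N⁺ G v → f u ≡ f v
    same→adj   : ∀ u v → f u ≡ f v → u ≢ v → u ~ v
    adj→parent : ∀ u v → u ~ v → f u ℕ.< f v → f u ≡ parent (f v)

-- These are the cyclic predecessor and successor of `i`, which differ because a cycle has at least
-- three vertices.
cycle-neighbours : ∀ {G} (c : Cycle G) (let open Graph G; open Cycle c) →
  ∀ i → ∃ λ j → ∃ λ k → j ≢ k × at j ~ at i × at k ~ at i
cycle-neighbours {G} c i = go i
  where
  open Graph G
  open Cycle c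
  go : ∀ i → ∃ λ j → ∃ λ k → j ≢ k × at j ~ at i × at k ~ at i
  go i with view i
  ... | ‵fromℕ            = inject₁ (fromℕ _) , zero , (λ ()) , step (fromℕ _) , ~-sym close
  ... | ‵inject₁ zero     = suc zero , fromℕ _ , (λ ()) , ~-sym (step zero) , close
  ... | ‵inject₁ (suc i′) = suc (suc i′) , inject₁ (inject₁ i′) , 2+i≢i i′ , ~-sym (step (suc i′)) , step (inject₁ i′)
    where
    2+i≢i : ∀ {n} (i : Fin n) → suc (suc i) ≢ inject₁ (inject₁ i)
    2+i≢i (suc i) eq = 2+i≢i i (suc-injective eq)

maximum : ∀ {n} (g : Fin (suc n) → ℕ) → ∃ λ top → ∀ j → g j ℕ.≤ g top
maximum {n} g = argmax g zero (allFin (suc n)) ,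
  λ j → All.lookup (f[xs]≤f[argmax] {f = g} zero (allFin (suc n))) (∈-allFin j)

acyclic : ∀ G (rank : Graph.Vertex G → ℕ) (parent : ℕ → ℕ) (let open Graph G) →
  (∀ {u v} → rank u ≡ rank v → u ≡ v) →
  (∀ {u v} → u ~ v → rank u ℕ.< rank v → rank u ≡ parent (rank v)) →
  ¬ Cycle G
acyclic G rank parent rank-injective lower≡parent c =
  let j , k , j≢k , j~top , k~top = cycle-neighbours c top
  in j≢k (injective (rank-injective (trans (below j j~top) (sym (below k k~top)))))
  where
  open Graph G
  open Cycle c
  maximal = maximum (rank ∘ at)
  top = proj₁ maximal
  below : ∀ j → at j ~ at top → rank (at j) ≡ parent (rank (at top))
  -- Maximality gives only a weak inequality; a tie would, by injectivity of `rank`, make `top`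
  -- adjacent to itself.
  below j j~top = lower≡parent j~top (ℕ.≤∧≢⇒< (proj₂ maximal j) ne)
    where
    ne : rank (at j) ≢ rank (at top)
    ne eq = ~-irrefl (subst (_~ at top) (rank-injective eq) j~top)

-- Partition into levels and its contraction.

record LevelPartition {n} (f : Fin n → ℕ) : Set where
  field
    partition : Partition n
  open Partition partition public
  field
    label           : Fin size → ℕ
    label-injective : ∀ {i j} → label i ≡ label j → i ≡ j
    ∈part⁺          : ∀ {i v} → f v ≡ label i → v Subset.∈ part i
    ∈part⁻          : ∀ {i v} → v Subset.∈ part i → f v ≡ label i

-- Parts are indexed by the list of values of `f` without duplicates: only attained values occur, so
-- parts are nonempty, and each occurs once, so `label` is injective.
levelPartition : ∀ {n} (f : Fin n → ℕ) → LevelPartition f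
levelPartition {n} f = record
  { partition = record
    { size     = List.length labels
    ; part     = λ i → ⟪ f≟ i ⟫
    ; nonempty = λ i →
        let v , _ , eq = ∈-map⁻ f (∈-deduplicate⁻ ℕ._≟_ (List.map f (allFin n)) (∈-lookup {xs = labels} i))
        in v , ∈⟪⟫⁺ (f≟ i) (sym eq)
    ; disjoint = λ {i} {j} v v∈i v∈j →
        label-injective (trans (sym (∈⟪⟫⁻ (f≟ i) v∈i)) (∈⟪⟫⁻ (f≟ j) v∈j))
    ; covering = λ v → Any.index (f∈labels v) , ∈⟪⟫⁺ (f≟ _) (lookup-index (f∈labels v))
    }
  ; label           = label
  ; label-injective = label-injective
  ; ∈part⁺          = λ {i} → ∈⟪⟫⁺ (f≟ i)
  ; ∈part⁻          = λ {i} → ∈⟪⟫⁻ (f≟ i)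
  }
  where
  labels : List ℕ
  labels = deduplicate ℕ._≟_ (List.map f (allFin n))

  label : Fin (List.length labels) → ℕ
  label = List.lookup labels

  label-injective : ∀ {i j} → label i ≡ label j → i ≡ j
  label-injective = lookup-injective (deduplicate-! ℕ._≟_ (List.map f (allFin n)))

  f≟_ : ∀ i v → Dec (f v ≡ label i)
  (f≟ i) v = f v ℕ.≟ label i

  f∈labels : ∀ v → f v List.∈ labels
  f∈labels v = ∈-deduplicate⁺ ℕ._≟_ (∈-map⁺ f (∈-allFin v))

module _ (G : Graph) {f : Graph.Vertex G → ℕ} (levels : LevelPartition f) where
  open Graph G
  open LevelPartition levels
  private
    H : Graph
    H = contract G partition
    module H = Graph H

    index : Vertex → Fin size
    index v = proj₁ (covering v)

    -- A step inside a part is dropped; a step between two parts becomes an edge of the contraction.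
    project : ∀ {u v} → Star _~_ u v → Star H._~_ (index u) (index v)
    project ε = ε
    project {u} {v} (_◅_ {j = w} u~w walk) with index u ≟ index w
    ... | yes eq = subst (λ i → Star H._~_ i (index v)) (sym eq) (project walk)
    ... | no  ne = (ne , u , w , proj₂ (covering u) , proj₂ (covering w) , u~w) ◅ project walk

  contract-connected : Connected G → Connected H
  contract-connected (root , walk) = index root , λ i j →
    let u , u∈i = nonempty i ; v , v∈j = nonempty j
    -- By disjointness, the index that `covering` picks for a vertex of part `i` is `i`.
    in subst₂ (Star H._~_)
         (disjoint u (proj₂ (covering u)) u∈i)
         (disjoint v (proj₂ (covering v)) v∈j)
         (project (walk u v))

  treeLabelling⇒BW₁ : Connected G → ∀ {parent} → TreeLabelling G parent f → BW₁ G
  treeLabelling⇒BW₁ connected {parent} labelling = bubblePartition ,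
    max≤v⁺ {⊥ = 0} z≤n (All.tabulate⁺ {n = size} {f = λ i → α (G [ part i ])} λ i →
      clique⇒α≤1 G λ u v u∈ v∈ u≢v →
        same→adj u v (trans (∈part⁻ u∈) (sym (∈part⁻ v∈))) u≢v)
    where
    open TreeLabelling labelling

    H-acyclic : ¬ Cycle H
    H-acyclic = acyclic H label parent label-injective
      λ (_ , u , v , u∈i , v∈j , u~v) i<j →
        let fu = ∈part⁻ u∈i ; fv = ∈part⁻ v∈j
        in trans (sym fu) (trans
             (adj→parent u v u~v (subst₂ ℕ._<_ (sym fu) (sym fv) i<j))
             (cong parent fv))

    bubblePartition : BubblePartition G
    bubblePartition = record
      { partition = partition
      ; bubbles   = λ i → unionOfBubbles G (part i) λ {u} {v} eq v∈ →
          ∈part⁺ (trans (twins→same u v eq) (∈part⁻ v∈))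
      ; tree      = contract-connected connected , H-acyclic
      }

twins≮⇒twins≡ : ∀ G {f : Graph.Vertex G → ℕ} → (∀ u v → N⁺ G u ≡ N⁺ G v → ¬ (f u ℕ.< f v)) →
           ∀ u v → N⁺ G u ≡ N⁺ G v → f u ≡ f v
twins≮⇒twins≡ G {f} f≮f u v eq = ℕ.≤-antisym (ℕ.≮⇒≥ (f≮f v u (sym eq))) (ℕ.≮⇒≥ (f≮f u v eq))

-- Split and co-bipartite graphs

module _ (G : Graph) where
  open Graph G

  clique⇒≃ : ∀ {K} → Clique K → ∀ {u v} → u Subset.∈ K → v Subset.∈ K → _≃_ G u v
  clique⇒≃ clique {u} {v} u∈K v∈K with u ≟ v
  ... | yes u≡v = inj₁ u≡v
  ... | no  u≢v = inj₂ (clique u v u∈K v∈K u≢v)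

  ≃⇒~ : ∀ {u v} → _≃_ G u v → u ≢ v → u ~ v
  ≃⇒~ (inj₁ u≡v) u≢v = ⊥-elim (u≢v u≡v)
  ≃⇒~ (inj₂ u~v) _   = u~v

-- Maximality keeps twins in one level: a vertex outside `K` with a twin in `K` would be adjacent to
-- all of `K`. Two vertices outside `K` are not adjacent, hence not twins.
maximalSplit⇒BW₁ : ∀ G (let open Graph G) → Connected G →
  ∀ {K} → Clique K → Independent (∁ K) → ¬ (∃ λ w → w Subset.∉ K × ∀ x → x Subset.∈ K → w ~ x) →
  BW₁ G
maximalSplit⇒BW₁ G connected {K} clique independent maximal =
  treeLabelling⇒BW₁ G (levelPartition f) connected {const 0} record
    { twins→same = twins≮⇒twins≡ G twins≮
    ; same→adj   = same→adj
    ; adj→parent = adj→parent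
    }
  where
  open Graph G

  f : Vertex → ℕ
  f v with v ∈? K
  ... | yes _ = 0
  ... | no  _ = suc (Fin.toℕ v)

  twins≮ : ∀ u v → N⁺ G u ≡ N⁺ G v → ¬ (f u ℕ.< f v)
  twins≮ u v eq fu<fv with u ∈? K | v ∈? K
  ... | yes u∈K | yes _   = ℕ.n≮0 fu<fv
  ... | no  _   | yes _   = ℕ.n≮0 fu<fv
  ... | yes u∈K | no  v∉K = maximal (v , v∉K , universal)
    where
    universal : ∀ x → x Subset.∈ K → v ~ x
    universal x x∈K with N⁺-≡⁻ G eq (clique⇒≃ G clique u∈K x∈K)
    ... | inj₁ refl = ⊥-elim (v∉K x∈K)
    ... | inj₂ v~x  = v~x
  ... | no u∉K | no v∉K with N⁺-≡⁻ G eq (inj₁ refl)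
  ... | inj₁ refl = ℕ.<-irrefl refl fu<fv
  ... | inj₂ v~u  = independent v u (Subset.x∉p⇒x∈∁p v∉K) (Subset.x∉p⇒x∈∁p u∉K) v~u

  same→adj : ∀ u v → f u ≡ f v → u ≢ v → u ~ v
  same→adj u v eq u≢v with u ∈? K | v ∈? K
  ... | yes u∈K | yes v∈K = clique u v u∈K v∈K u≢v
  ... | no  _   | no  _   = ⊥-elim (u≢v (toℕ-injective (ℕ.suc-injective eq)))

  adj→parent : ∀ u v → u ~ v → f u ℕ.< f v → f u ≡ 0
  adj→parent u v u~v fu<fv with u ∈? K | v ∈? K
  ... | yes _  | _      = refl
  ... | no _   | yes _  = ⊥-elim (ℕ.n≮0 fu<fv)
  ... | no u∉K | no v∉K = ⊥-elim (independent u v (Subset.x∉p⇒x∈∁p u∉K) (Subset.x∉p⇒x∈∁p v∉K) u~v)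

-- One enlargement makes the clique maximal: a further vertex adjacent to all of `K` would be
-- adjacent to `w`, although both come from the independent set.
split⇒BW₁ : ∀ G → Connected G → Split G → BW₁ G
split⇒BW₁ G connected (S , clique , independent) =
  extend (any? λ w → ¬? (w ∈? S) ×-dec all? λ x → (x ∈? S) →-dec (w ~? x))
  where
  open Graph G

  extend : Dec (∃ λ w → w Subset.∉ S × ∀ x → x Subset.∈ S → w ~ x) → BW₁ G
  extend (no maximal) = maximalSplit⇒BW₁ G connected clique independent maximal
  extend (yes (w , w∉S , w~S)) = maximalSplit⇒BW₁ G connected clique′
    (λ u v u∉ v∉ → independent u v (shrink u∉) (shrink v∉)) λ (x , x∉ , x~) →
      independent x w (shrink (Subset.x∉p⇒x∈∁p x∉)) (Subset.x∉p⇒x∈∁p w∉S)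
        (x~ w (x∈p∪q⁺ (inj₂ (x∈⁅x⁆ w))))
    where
    K : VertexSet
    K = S Subset.∪ ⁅ w ⁆

    shrink : ∁ K Subset.⊆ ∁ S
    shrink = Subset.p⊆q⇒∁p⊇∁q λ u∈S → x∈p∪q⁺ (inj₁ u∈S)

    clique′ : Clique K
    clique′ u v u∈ v∈ u≢v with x∈p∪q⁻ S ⁅ w ⁆ u∈ | x∈p∪q⁻ S ⁅ w ⁆ v∈
    ... | inj₁ u∈S | inj₁ v∈S = clique u v u∈S v∈S u≢v
    ... | inj₁ u∈S | inj₂ v∈w rewrite Subset.x∈⁅y⁆⇒x≡y w v∈w = ~-sym (w~S u u∈S)
    ... | inj₂ u∈w | inj₁ v∈S rewrite Subset.x∈⁅y⁆⇒x≡y w u∈w = w~S v v∈S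
    ... | inj₂ u∈w | inj₂ v∈w = ⊥-elim (u≢v
      (trans (Subset.x∈⁅y⁆⇒x≡y w u∈w) (sym (Subset.x∈⁅y⁆⇒x≡y w v∈w))))

twoCliques⇒BW₁ : ∀ G (let open Graph G) → Connected G → {L : Vertex → Set} → (∀ v → Dec (L v)) →
  (∀ {u v} → N⁺ G u ≡ N⁺ G v → L u → L v) →
  (∀ {u v} → L u → L v → u ≢ v → u ~ v) →
  (∀ {u v} → ¬ L u → ¬ L v → u ≢ v → u ~ v) →
  BW₁ G
twoCliques⇒BW₁ G connected L? closed cliqueˡ cliqueʳ =
  treeLabelling⇒BW₁ G (levelPartition f) connected {const 0} record
    { twins→same = twins≮⇒twins≡ G twins≮
    ; same→adj   = same→adj
    ; adj→parent = adj→parent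
    }
  where
  open Graph G

  f : Vertex → ℕ
  f v = if does (L? v) then 0 else 1

  twins≮ : ∀ u v → N⁺ G u ≡ N⁺ G v → ¬ (f u ℕ.< f v)
  twins≮ u v eq fu<fv with L? u | L? v
  ... | _      | yes _  = ℕ.n≮0 fu<fv
  ... | no  _  | no  _  = ℕ.<-irrefl refl fu<fv
  ... | yes Lu | no ¬Lv = ¬Lv (closed eq Lu)

  same→adj : ∀ u v → f u ≡ f v → u ≢ v → u ~ v
  same→adj u v eq u≢v with L? u | L? v
  ... | yes Lu | yes Lv = cliqueˡ Lu Lv u≢v
  ... | no ¬Lu | no ¬Lv = cliqueʳ ¬Lu ¬Lv u≢v

  adj→parent : ∀ u v → u ~ v → f u ℕ.< f v → f u ≡ 0
  adj→parent u v _ fu<fv with L? u | L? v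
  ... | yes _ | _     = refl
  ... | no _  | yes _ = ⊥-elim (ℕ.n≮0 fu<fv)
  ... | no _  | no _  = ⊥-elim (ℕ.<-irrefl refl fu<fv)

-- A bubble meeting both cliques consists of universal vertices, so it suffices to move all of those
-- to one side.
coBipartite⇒BW₁ : ∀ G → Connected G → CoBipartite G → BW₁ G
coBipartite⇒BW₁ G connected (S , cliqueˡ , cliqueʳ) =
  twoCliques⇒BW₁ G connected {Left} (λ v → (v ∈? S) ⊎-dec all? (_≃?_ G v)) closed left
    λ u∉ v∉ → cliqueʳ _ _ (right u∉) (right v∉)
  where
  open Graph G

  Universal Left : Vertex → Set
  Universal u = ∀ v → _≃_ G u v
  Left v = v Subset.∈ S ⊎ Universal v

  right : ∀ {v} → ¬ Left v → v Subset.∈ ∁ S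
  right v∉ = Subset.x∉p⇒x∈∁p (v∉ ∘ inj₁)

  closed : ∀ {u v} → N⁺ G u ≡ N⁺ G v → Left u → Left v
  closed eq (inj₂ univ) = inj₂ λ w → N⁺-≡⁻ G eq (univ w)
  closed {u} {v} eq (inj₁ u∈S) with v ∈? S
  ... | yes v∈S = inj₁ v∈S
  ... | no  v∉S = inj₂ univ
    where
    -- Vertices of `S` are neighbours of the twin `u`, hence of `v`; the others share the clique
    -- `∁ S` with `v`.
    univ : Universal v
    univ w with w ∈? S
    ... | yes w∈S = N⁺-≡⁻ G eq (clique⇒≃ G cliqueˡ u∈S w∈S)
    ... | no  w∉S = clique⇒≃ G cliqueʳ (Subset.x∉p⇒x∈∁p v∉S) (Subset.x∉p⇒x∈∁p w∉S)

  left : ∀ {u v} → Left u → Left v → u ≢ v → u ~ v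
  left (inj₁ u∈S)  (inj₁ v∈S)  u≢v = cliqueˡ _ _ u∈S v∈S u≢v
  left (inj₁ _)    (inj₂ univ) u≢v = ~-sym (≃⇒~ G (univ _) (u≢v ∘ sym))
  left (inj₂ univ) _           u≢v = ≃⇒~ G (univ _) u≢v

-- The real line

-- The order on ℝ unfolds to statements about cuts, from which the reals cannot be inferred; hence the
-- explicit arguments.
<-≤-trans : ∀ x y z → x < y → y ≤ z → x < z
<-≤-trans x y z (q , x<q , q<y) y≤z with ℝ.lower-open y q<y
-- Locatedness needs a gap between two rationals; openness of the cut `y` supplies it.
... | r , q<r , r<y with ℝ.located z q<r
... | inj₁ q<z = q , x<q , q<z
... | inj₂ z<r = ⊥-elim (y≤z (r , z<r , r<y))

≤-<-trans : ∀ x y z → x ≤ y → y < z → x < z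
≤-<-trans x y z x≤y (q , y<q , q<z) with ℝ.upper-open y y<q
... | p , p<q , y<p with ℝ.located x p<q
... | inj₁ p<x = ⊥-elim (x≤y (p , y<p , p<x))
... | inj₂ x<q = q , x<q , q<z

<-irrefl : ∀ x → ¬ (x < x)
<-irrefl x (q , x<q , q<x) = ℝ.disjoint x (q<x , x<q)

<-trans : ∀ x y z → x < y → y < z → x < z
<-trans x y z (p , x<p , p<y) (q , y<q , q<z) with ℚ.<-cmp p q
... | tri< p<q _ _  = q , ℝ.upper-closed x p<q x<p , q<z
... | tri≈ _ refl _ = q , x<p , q<z
... | tri> _ _ q<p  = ⊥-elim (ℝ.disjoint y (p<y , ℝ.upper-closed y q<p y<q))

<⇒≤ : ∀ x y → x < y → x ≤ y
<⇒≤ x y x<y y<x = <-irrefl x (<-trans x y x x<y y<x)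

≤-trans : ∀ x y z → x ≤ y → y ≤ z → x ≤ z
≤-trans x y z x≤y y≤z z<x = x≤y (≤-<-trans y z x y≤z z<x)

p+q-q≡p : ∀ p q → p ℚ.+ q ℚ.- q ≡ p
p+q-q≡p p q = trans (ℚ.+-assoc p q (ℚ.- q))
  (trans (cong (p ℚ.+_) (ℚ.+-inverseʳ q)) (ℚ.+-identityʳ p))

p<p+1 : ∀ p → p ℚ.< p ℚ.+ 1ℚ
p<p+1 p = subst (ℚ._< p ℚ.+ 1ℚ) (ℚ.+-identityʳ p) (ℚ.+-monoʳ-< p (ℚ.positive⁻¹ 1ℚ))

p-1<p : ∀ p → p ℚ.- 1ℚ ℚ.< p
p-1<p p = subst (p ℚ.- 1ℚ ℚ.<_) (ℚ.+-identityʳ p) (ℚ.+-monoʳ-< p (ℚ.negative⁻¹ (ℚ.- 1ℚ)))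

+-mono-< : ∀ x y t → x < y → x + t < y + t
+-mono-< x y t (q , x<q , q<y) = q ℚ.+ t ,
  subst (ℝ.Upper x) (sym (p+q-q≡p q t)) x<q ,
  subst (ℝ.Lower y) (sym (p+q-q≡p q t)) q<y

+-mono-≤ : ∀ x y t → x ≤ y → x + t ≤ y + t
+-mono-≤ x y t x≤y (q , y+t<q , q<x+t) = x≤y (q ℚ.- t , y+t<q , q<x+t)

-- The Archimedean property and unit translation.

-- Repeated addition of `1ℚ` matches the unit steps of `climb` below.
ℕ→ℚ : ℕ → ℚ
ℕ→ℚ zero    = 0ℚ
ℕ→ℚ (suc k) = ℕ→ℚ k ℚ.+ 1ℚ

toℚᵘ-ℕ→ℚ : ∀ k → ℚ.toℚᵘ (ℕ→ℚ k) ℚᵘ.≃ ℚᵘ.mkℚᵘ (ℤ.+ k) 0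
toℚᵘ-ℕ→ℚ zero    = ℚᵘ.*≡* refl
toℚᵘ-ℕ→ℚ (suc k) = ℚᵘ.≃-trans (ℚ.toℚᵘ-homo-+ (ℕ→ℚ k) 1ℚ)
  (ℚᵘ.≃-trans (ℚᵘ.+-congˡ ℚᵘ.1ℚᵘ (toℚᵘ-ℕ→ℚ k)) (ℚᵘ.*≡* (cong (ℤ._* ℤ.1ℤ) eq)))
  where
  eq : (ℤ.+ k) ℤ.* ℤ.1ℤ ℤ.+ ℤ.1ℤ ≡ ℤ.+ suc k
  eq = trans (cong (ℤ._+ ℤ.1ℤ) (ℤ.*-identityʳ (ℤ.+ k))) (cong ℤ.+_ (ℕ.+-comm k 1))

archimedean : ∀ q → ∃ λ k → q ℚ.≤ ℕ→ℚ k
archimedean q@record{} = k , ℚ.toℚᵘ-cancel-≤ (ℚᵘ.≤-respʳ-≃ (ℚᵘ.≃-sym (toℚᵘ-ℕ→ℚ k)) (ℚᵘ.*≤* le))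
  where
  -- The denominator is at least 1, so the absolute value of the numerator bounds the fraction.
  k = ℤ.∣ ℚ.↥ q ∣
  le : ℚ.↥ q ℤ.* ℤ.1ℤ ℤ.≤ (ℤ.+ k) ℤ.* ℚ.↧ q
  le = subst₂ ℤ._≤_ (sym (ℤ.*-identityʳ (ℚ.↥ q))) (ℤ.pos-* k (ℚ.↧ₙ q))
    (ℤ.≤-trans (i≤+∣i∣ (ℚ.↥ q)) (ℤ.+≤+ (ℕ.m≤m*n k (ℚ.↧ₙ q))))
    where
    i≤+∣i∣ : ∀ i → i ℤ.≤ ℤ.+ ℤ.∣ i ∣
    i≤+∣i∣ (ℤ.+ n)    = ℤ.≤-refl
    i≤+∣i∣ ℤ.-[1+ n ] = ℤ.-≤+

-- From a lower bound q, either a point of (x , x + 1) shows up or q + 1 is again a lower bound; the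
-- latter cannot go on forever.
x<x+1 : ∀ x → x < x + 1ℚ
x<x+1 x = [ (λ lt → lt) , (λ a+k<x → ⊥-elim (absurd a+k<x)) ]′ (climb k)
  where
  open ℝ x
  a = proj₁ lower-inhabited
  b = proj₁ upper-inhabited
  -- After `k` unit steps the lower bound `a` would reach the upper bound `b`.
  k = proj₁ (archimedean (b ℚ.- a))

  halfStep : ∀ {q r} → r ℚ.< q ℚ.+ 1ℚ → Lower q → x < x + 1ℚ ⊎ Lower r
  halfStep {q} r<q+1 q<x with located r<q+1
  ... | inj₁ r<x   = inj₂ r<x
  ... | inj₂ x<q+1 = inj₁ (q ℚ.+ 1ℚ , x<q+1 , subst Lower (sym (p+q-q≡p q 1ℚ)) q<x)

  step : ∀ {q} → Lower q → x < x + 1ℚ ⊎ Lower (q ℚ.+ 1ℚ)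
  -- `halfStep` advances by strictly less than 1, so a full unit takes two of them, via some `r`
  -- between `q` and `q ℚ.+ 1ℚ`.
  step {q} q<x with ℚ.<-dense (p<p+1 q)
  ... | r , q<r , r<q+1 = [ inj₁ , halfStep (ℚ.+-monoˡ-< 1ℚ q<r) ]′ (halfStep r<q+1 q<x)

  climb : ∀ k → x < x + 1ℚ ⊎ Lower (a ℚ.+ ℕ→ℚ k)
  climb zero    = inj₂ (subst Lower (sym (ℚ.+-identityʳ a)) (proj₂ lower-inhabited))
  climb (suc k) = [ inj₁ , (λ l → Sum.map₂ (subst Lower (ℚ.+-assoc a (ℕ→ℚ k) 1ℚ)) (step l)) ]′ (climb k)

  b≤a+k : b ℚ.≤ a ℚ.+ ℕ→ℚ k
  b≤a+k = subst (ℚ._≤ a ℚ.+ ℕ→ℚ k)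
    (trans (ℚ.+-comm a (b ℚ.- a)) (trans (ℚ.+-assoc b (ℚ.- a) a)
      (trans (cong (b ℚ.+_) (ℚ.+-inverseˡ a)) (ℚ.+-identityʳ b))))
    (ℚ.+-monoʳ-≤ a (proj₂ (archimedean (b ℚ.- a))))

  absurd : ¬ Lower (a ℚ.+ ℕ→ℚ k)
  absurd l = let r , a+k<r , r<x = lower-open l
             in disjoint (lower-closed (ℚ.≤-<-trans b≤a+k a+k<r) r<x , proj₂ upper-inhabited)

fromℚ : ℚ → ℝ
fromℚ q = record
  { Lower           = ℚ._< q
  ; Upper           = q ℚ.<_
  ; lower-inhabited = q ℚ.- 1ℚ , p-1<p q
  ; upper-inhabited = q ℚ.+ 1ℚ , p<p+1 q
  ; lower-closed    = ℚ.<-trans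
  ; upper-closed    = λ r<s q<r → ℚ.<-trans q<r r<s
  ; lower-open      = λ r<q → let s , r<s , s<q = ℚ.<-dense r<q in s , r<s , s<q
  ; upper-open      = λ q<r → let s , q<s , s<r = ℚ.<-dense q<r in s , s<r , q<s
  ; disjoint        = λ (r<q , q<r) → ℚ.<-asym r<q q<r
  ; located         = located
  }
  where
  located : ∀ {r s} → r ℚ.< s → r ℚ.< q ⊎ q ℚ.< s
  located {r} r<s with r ℚ.<? q
  ... | yes r<q = inj₁ r<q
  ... | no  r≮q = inj₂ (ℚ.≤-<-trans (ℚ.≮⇒≥ r≮q) r<s)

dense : ∀ x y → x < y → ∃ λ z → x < z × z < y
dense x y (q , x<q , q<y) =
  let p , p<q , x<p = ℝ.upper-open x x<q ; r , q<r , r<y = ℝ.lower-open y q<y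
  in fromℚ q , (p , x<p , p<q) , (r , q<r , r<y)

-- Unit intervals

open UnitInterval

-- Endpoint types are inspected only here and in `⊆closure`: intersections are produced at interior
-- points and refuted on closures.
interior⊆ : ∀ I x → left I < x → x < right I → Contains I x
interior⊆ I x l<x x<r = bound (leftClosed I) (left I) x l<x , bound (rightClosed I) x (right I) x<r
  where
  bound : ∀ b x y → x < y → if b then x ≤ y else x < y
  bound true  x y x<y = <⇒≤ x y x<y
  bound false x y x<y = x<y

⊆closure : ∀ I x → Contains I x → left I ≤ x × x ≤ right I
⊆closure I x (l , r) = bound (leftClosed I) (left I) x l , bound (rightClosed I) x (right I) r
  where
  bound : ∀ b x y → (if b then x ≤ y else x < y) → x ≤ y
  bound true  x y x≤y = x≤y
  bound false x y x<y = <⇒≤ x y x<y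

-- A point strictly between `left J` and `right I` is interior to both intervals.
intersect-ordered : ∀ I J → left I ≤ left J → left J < right I → Intersect I J
intersect-ordered I J lI≤lJ lJ<rI =
  let x , lJ<x , x<rI = dense (left J) (right I) lJ<rI
  in x , interior⊆ I x (≤-<-trans (left I) (left J) x lI≤lJ lJ<x) x<rI ,
         interior⊆ J x lJ<x (<-≤-trans x (right I) (right J) x<rI (+-mono-≤ (left I) (left J) 1ℚ lI≤lJ))

intersect-self : ∀ I → Intersect I I
intersect-self I = intersect-ordered I I (<-irrefl (left I)) (x<x+1 (left I))

-- A common point `x` would give `right J ≤ left K ≤ x ≤ right I`, against `right I < right J`.
disjoint-beyond : ∀ I J K → left I < left J → right J ≤ left K → ¬ Intersect I K
disjoint-beyond I J K lI<lJ rJ≤lK (x , x∈I , x∈K) =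
  ≤-trans (right J) (left K) (right I) rJ≤lK
    (≤-trans (left K) x (right I) (proj₁ (⊆closure K x x∈K)) (proj₂ (⊆closure I x x∈I)))
    (+-mono-< (left I) (left J) 1ℚ lI<lJ)

-- Finite search and double negation

-- Labellings with bounded values are searched as vectors, which can be enumerated coordinate by
-- coordinate.
anyVec? : ∀ {m} n {P : Vec (Fin m) n → Set} → (∀ xs → Dec (P xs)) → Dec (∃ P)
anyVec? zero    P? = map′ (λ p → [] , p) (λ { ([] , p) → p }) (P? [])
anyVec? (suc n) P? = map′
  (λ (x , xs , p) → x ∷ xs , p)
  (λ { (x ∷ xs , p) → x , xs , p })
  (any? λ x → anyVec? n λ xs → P? (x ∷ xs))

-- Double negation shift for a finite index set, by sequencing in the double negation applicative.
¬¬-finite : ∀ {n} {P : Fin n → Set} → (∀ i → ¬ ¬ P i) → ¬ ¬ (∀ i → P i)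
¬¬-finite = sequence (RawMonad.rawApplicative ¬¬-Monad)

greatest : ∀ {P : ℕ → Set} → (∀ k → Dec (P k)) → P 0 → ∀ b → (∀ k → P k → k ℕ.≤ b) →
           ∃ λ k → P k × ¬ P (suc k)
greatest P? p0 zero    bound = 0 , p0 , λ p1 → ℕ.n≮0 (bound 1 p1)
greatest P? p0 (suc b) bound with P? (suc b)
... | yes p = suc b , p , λ p′ → ℕ.1+n≰n (bound (suc (suc b)) p′)
... | no ¬p = greatest P? p0 b λ k pk →
  ℕ.≤-pred (ℕ.≤∧≢⇒< (bound k pk) λ { refl → ¬p pk })

module _ (G : Graph) (parent : ℕ → ℕ) where
  open Graph G

  treeLabelling? : ∀ f → Dec (TreeLabelling G parent f)
  treeLabelling? f = map′
    (λ (t , s , a) → record { twins→same = t ; same→adj = s ; adj→parent = a })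
    (λ l → let open TreeLabelling l in twins→same , same→adj , adj→parent)
    ((all? λ u → all? λ v → _≗ᴺ?_ G u v →-dec f u ℕ.≟ f v)
     ×-dec (all? λ u → all? λ v → (f u ℕ.≟ f v) →-dec ¬? (u ≟ v) →-dec (u ~? v))
     ×-dec (all? λ u → all? λ v → (u ~? v) →-dec (f u ℕ.<? f v) →-dec (f u ℕ.≟ parent (f v))))

  treeLabelling-cong : ∀ {f g} → (∀ v → f v ≡ g v) → TreeLabelling G parent f → TreeLabelling G parent g
  treeLabelling-cong f≗g l = record
    { twins→same = λ u v eq → subst₂ _≡_ (f≗g u) (f≗g v) (twins→same u v eq)
    ; same→adj   = λ u v eq → same→adj u v (trans (f≗g u) (trans eq (sym (f≗g v))))
    ; adj→parent = λ u v u~v lt → trans (sym (f≗g u))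
        (trans (adj→parent u v u~v (subst₂ ℕ._<_ (sym (f≗g u)) (sym (f≗g v)) lt)) (cong parent (f≗g v)))
    }
    where open TreeLabelling l

-- Mixed unit interval graphs

-- Once twins share an interval, distinct vertices may have the same one, so intersection is matched
-- with the reflexive relation ≃ rather than with ~.
record TwinModel (G : Graph) : Set₁ where
  field
    interval    : Graph.Vertex G → UnitInterval
    ≃→intersect : ∀ u v → _≃_ G u v → Intersect (interval u) (interval v)
    intersect→≃ : ∀ u v → Intersect (interval u) (interval v) → _≃_ G u v
    twins→≡     : ∀ u v → N⁺ G u ≡ N⁺ G v → interval u ≡ interval v

twinModel : ∀ G → MixedUnitInterval G → TwinModel G
twinModel G (I , model) = record
  { interval    = λ v → I (rep v)
  ; ≃→intersect = λ u v u≃v → ≃→intersect (rep u) (rep v) (to-rep u v u≃v)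
  ; intersect→≃ = λ u v meet → from-rep u v (intersect→≃ (rep u) (rep v) meet)
  ; twins→≡     = λ u v eq → cong I (pick-cong eq _ _)
  }
  where
  open Graph G

  -- The witness is irrelevant: `recompute` obtains one from the decision procedure, so the result
  -- depends on `B` alone and twins get the same representative.
  pick : ∀ B → .(∃ λ w → N⁺ G w ≡ B) → ∃ λ w → N⁺ G w ≡ B
  pick B = recompute (any? λ w → Vec.≡-dec Bool._≟_ (N⁺ G w) B)

  pick-cong : ∀ {B C} → B ≡ C → .(p : ∃ λ w → N⁺ G w ≡ B) .(q : ∃ λ w → N⁺ G w ≡ C) →
              proj₁ (pick B p) ≡ proj₁ (pick C q)
  pick-cong refl p q = refl

  rep : Vertex → Vertex
  rep v = proj₁ (pick (N⁺ G v) (v , refl))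

  N⁺-rep : ∀ v → N⁺ G (rep v) ≡ N⁺ G v
  N⁺-rep v = proj₂ (pick (N⁺ G v) (v , refl))

  to-rep : ∀ u v → _≃_ G u v → _≃_ G (rep u) (rep v)
  to-rep u v u≃v = ≃-sym G (N⁺-≡⁻ G (sym (N⁺-rep v)) (≃-sym G (N⁺-≡⁻ G (sym (N⁺-rep u)) u≃v)))

  from-rep : ∀ u v → _≃_ G (rep u) (rep v) → _≃_ G u v
  from-rep u v r≃r = ≃-sym G (N⁺-≡⁻ G (N⁺-rep v) (≃-sym G (N⁺-≡⁻ G (N⁺-rep u) r≃r)))

  ≃→intersect : ∀ u v → _≃_ G u v → Intersect (I u) (I v)
  ≃→intersect u v (inj₁ refl) = intersect-self (I u)
  ≃→intersect u v (inj₂ u~v)  = proj₂ (Equivalence.to (model u v) u~v)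

  intersect→≃ : ∀ u v → Intersect (I u) (I v) → _≃_ G u v
  intersect→≃ u v meet with u ≟ v
  ... | yes u≡v = inj₁ u≡v
  ... | no  u≢v = inj₂ (Equivalence.from (model u v) (u≢v , meet))

-- Labelling by longest chains of unit steps.

module _ (G : Graph) (M : TwinModel G)
         (_<?_ : ∀ u v → Dec (left (TwinModel.interval M u) < left (TwinModel.interval M v)))
         (_<+1?_ : ∀ u v → Dec (left (TwinModel.interval M u) < right (TwinModel.interval M v))) where
  open Graph G
  open TwinModel M

  private
    l r : Vertex → ℝ
    l v = left (interval v)
    r v = right (interval v)

    infix 4 _≺_
    _≺_ : Vertex → Vertex → Set
    u ≺ v = r u ≤ l v

  Chain : ℕ → Vertex → Set
  Chain zero    v = ⊤
  Chain (suc k) v = ∃ λ u → u ≺ v × Chain k u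

  chain? : ∀ k v → Dec (Chain k v)
  chain? zero    v = yes tt
  -- `u ≺ v` unfolds to the negation of `l v < r u`.
  chain? (suc k) v = any? λ u → ¬? (v <+1? u) ×-dec chain? k u

  chain-shorten : ∀ k {v} → Chain (suc k) v → Chain k v
  chain-shorten zero    _             = tt
  chain-shorten (suc k) (u , u≺v , c) = u , u≺v , chain-shorten k c

  chain-≤ : ∀ {j k v} → j ℕ.≤′ k → Chain k v → Chain j v
  chain-≤ ℕ.≤′-refl       c = c
  chain-≤ (ℕ.≤′-step j≤k) c = chain-≤ j≤k (chain-shorten _ c)

  chain-mono : ∀ k {u v} → l u ≤ l v → Chain k u → Chain k v
  chain-mono zero            lu≤lv _             = tt
  chain-mono (suc k) {u} {v} lu≤lv (w , w≺u , c) = w , ≤-trans (r w) (l u) (l v) w≺u lu≤lv , c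

  below : Vertex → VertexSet
  below v = ⟪ _<? v ⟫

  -- A unit step from `u` to `v` adds at least `u` itself to the vertices further left; this bounds
  -- the length of chains.
  ≺⇒∣below∣< : ∀ {u v} → u ≺ v → ∣ below u ∣ ℕ.< ∣ below v ∣
  ≺⇒∣below∣< {u} {v} u≺v = Subset.p⊂q⇒∣p∣<∣q∣
    ( (λ {w} w∈ → ∈⟪⟫⁺ (_<? v) (<-trans (l w) (l u) (l v) (∈⟪⟫⁻ (_<? u) w∈) lu<lv))
    , u , ∈⟪⟫⁺ (_<? v) lu<lv , λ u∈ → <-irrefl (l u) (∈⟪⟫⁻ (_<? u) u∈))
    where
    lu<lv : l u < l v
    lu<lv = <-≤-trans (l u) (r u) (l v) (x<x+1 (l u)) u≺v

  chain-bound : ∀ k v → Chain k v → k ℕ.≤ ∣ below v ∣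
  chain-bound zero    v _             = z≤n
  chain-bound (suc k) v (u , u≺v , c) = ℕ.≤-trans (s≤s (chain-bound k u c)) (≺⇒∣below∣< u≺v)

  private
    longest : ∀ v → ∃ λ k → Chain k v × ¬ Chain (suc k) v
    longest v = greatest (λ k → chain? k v) tt ∣ below v ∣ (λ k → chain-bound k v)

    f : Vertex → ℕ
    f v = proj₁ (longest v)

    chain⇒≤f : ∀ {k v} → Chain k v → k ℕ.≤ f v
    chain⇒≤f {k} {v} c with k ℕ.≤? f v
    ... | yes k≤f = k≤f
    ... | no  k≰f = ⊥-elim (proj₂ (proj₂ (longest v)) (chain-≤ (ℕ.≤⇒≤′ (ℕ.≰⇒> k≰f)) c))

    f-mono : ∀ {u v} → l u ≤ l v → f u ℕ.≤ f v
    f-mono {u} lu≤lv = chain⇒≤f (chain-mono (f u) lu≤lv (proj₁ (proj₂ (longest u))))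

    f-≺ : ∀ {u v} → u ≺ v → f u ℕ.< f v
    f-≺ {u} u≺v = chain⇒≤f (u , u≺v , proj₁ (proj₂ (longest u)))

    close⇒≃ : ∀ u v → l u < r v → l v < r u → _≃_ G u v
    close⇒≃ u v lu<rv lv<ru with v <? u
    ... | yes lv<lu = ≃-sym G (intersect→≃ v u
      (intersect-ordered (interval v) (interval u) (<⇒≤ (l v) (l u) lv<lu) lu<rv))
    ... | no  lv≮lu = intersect→≃ u v (intersect-ordered (interval u) (interval v) lv≮lu lv<ru)

    -- A unit step between the two vertices would raise the label, so their left endpoints are less
    -- than 1 apart.
    same→adj : ∀ u v → f u ≡ f v → u ≢ v → u ~ v
    same→adj u v eq u≢v with u <+1? v | v <+1? u
    ... | yes lu<rv | yes lv<ru = ≃⇒~ G (close⇒≃ u v lu<rv lv<ru) u≢v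
    ... | no  v≺u   | _         = ⊥-elim (ℕ.<-irrefl (sym eq) (f-≺ v≺u))
    ... | _         | no  u≺v   = ⊥-elim (ℕ.<-irrefl eq (f-≺ u≺v))

    -- Let `w` precede `v` on a longest chain. If `u` started before `w`, it would end before `w`
    -- does and miss `v`. So `u` starts no earlier than `w` and inherits its chain of length `k`.
    adj→parent : ∀ u v → u ~ v → f u ℕ.< f v → f u ≡ ℕ.pred (f v)
    adj→parent u v u~v fu<fv with f v | proj₁ (proj₂ (longest v))
    ... | suc k | w , w≺v , c = ℕ.≤-antisym (ℕ.≤-pred fu<fv) (ℕ.≮⇒≥ λ fu<k →
      let lw≤lu : l w ≤ l u
          lw≤lu lu<lw = disjoint-beyond (interval u) (interval w) (interval v) lu<lw w≺v
            (≃→intersect u v (inj₂ u~v))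
      in ℕ.<-irrefl refl (ℕ.<-≤-trans fu<k (chain⇒≤f (chain-mono k lw≤lu c))))

    labelling : TreeLabelling G ℕ.pred f
    labelling = record
      { twins→same = λ u v eq → ℕ.≤-antisym (f-mono (same-left eq)) (f-mono (same-left (sym eq)))
      ; same→adj   = same→adj
      ; adj→parent = adj→parent
      }
      where
      same-left : ∀ {u v} → N⁺ G u ≡ N⁺ G v → l u ≤ l v
      same-left {u} {v} eq = subst (λ I → l u ≤ left I) (twins→≡ u v eq) (<-irrefl (l u))

    f<1+order : ∀ v → f v ℕ.< suc order
    f<1+order v = s≤s (ℕ.≤-trans (chain-bound (f v) v (proj₁ (proj₂ (longest v)))) (Subset.∣p∣≤n (below v)))

  boundedLabelling : ∃ λ (xs : Vec (Fin (suc order)) order) → TreeLabelling G ℕ.pred (Fin.toℕ ∘ Vec.lookup xs)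
  boundedLabelling = Vec.tabulate g , treeLabelling-cong G ℕ.pred
    (λ v → sym (trans (cong Fin.toℕ (Vec.lookup∘tabulate g v)) (toℕ-fromℕ< (f<1+order v)))) labelling
    where
    g : Vertex → Fin (suc order)
    g v = Fin.fromℕ< (f<1+order v)

-- Comparing endpoints is not decidable, but the existence of a labelling with bounded values is, so
-- finitely many comparisons may be assumed to be decided.
mixedUnitInterval⇒BW₁ : ∀ G → Connected G → MixedUnitInterval G → BW₁ G
mixedUnitInterval⇒BW₁ G connected mixed =
  let xs , labelling = decidable-stable
        (anyVec? order λ xs → treeLabelling? G ℕ.pred (Fin.toℕ ∘ Vec.lookup xs))
        (¬¬-map (λ _<?_ → boundedLabelling G M (λ u v → proj₁ (u <? v)) (λ u v → proj₂ (u <? v))) decided)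
  in treeLabelling⇒BW₁ G (levelPartition (Fin.toℕ ∘ Vec.lookup xs)) connected labelling
  where
  open Graph G
  M = twinModel G mixed
  open TwinModel M

  decided : ¬ ¬ (∀ u v → Dec (left (interval u) < left (interval v)) × Dec (left (interval u) < right (interval v)))
  decided = ¬¬-finite λ u → ¬¬-finite λ v h →
    ¬¬-excluded-middle λ a → ¬¬-excluded-middle λ b → h (a , b)

mainTheorem5 : ∀ (G : Graph) → Connected G → G ∈ Split ∪ CoBipartite ∪ MixedUnitInterval → G ∈ BW₁
mainTheorem5 G connected (inj₁ split)        = split⇒BW₁ G connected split
mainTheorem5 G connected (inj₂ (inj₁ cobip)) = coBipartite⇒BW₁ G connected cobip
mainTheorem5 G connected (inj₂ (inj₂ mixed)) = mixedUnitInterval⇒BW₁ G connected mixed
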